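{- Let $t$ be a term of the $\lambda!$-calculus. Then $t$ is $\mathcal U$-typable if and only if $t$ $\mathtt w$-normalises to some term $p\in\mathsf{no}_{\mathtt{wcf}}$ (i.e. $t\twoheadrightarrow_{\mathtt w}p$ for some such $p$). Moreover, if $\Phi$ is a derivation of $\Gamma\vdash t:\tau$ in system $\mathcal U$, then there are $p\in\mathsf{no}_{\mathtt{wcf}}$ and natural numbers $b,e$ such that $t\twoheadrightarrow_{\mathtt w}^{(b,e)}p$ and $\mathtt{sz}(\Phi)\ge b+e+|p|_{\mathtt w}$.
   Context: Terms of the $\lambda!$-calculus: $t,u ::= x \mid t\,u \mid \lambda x.t \mid {!t} \mid \mathrm{der}\,t \mid t[x\backslash u]$, where $[x\backslash u]$ is a syntactic explicit substitution; $\lambda x.t$ and $t[x\backslash u]$ bind $x$ in $t$; terms are modulo $\alpha$-conversion. $t\{x\backslash u\}$ is capture-avoiding meta-level substitution. List contexts: $L ::= \Box \mid L[x\backslash t]$. Weak contexts: $W ::= \Box \mid W\,t \mid t\,W \mid \lambda x.W \mid \mathrm{der}\,W \mid W[x\backslash u] \mid t[x\backslash W]$. $C\langle t\rangle$ is the result of plugging $t$ in the hole of $C$. Rules (avoiding capture): $\mathtt{dB}$: $L\langle\lambda x.t\rangle\,u \mapsto L\langle t[x\backslash u]\rangle$; $\mathtt{s!}$: $t[x\backslash L\langle !u\rangle] \mapsto L\langle t\{x\backslash u\}\rangle$; $\mathtt{d!}$: $\mathrm{der}(L\langle !t\rangle)\mapsto L\langle t\rangle$. $\to_{\mathtt w}$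 is the closure of the three rules under weak contexts, $\twoheadrightarrow_{\mathtt w}$ its reflexive-transitive closure; $t\twoheadrightarrow_{\mathtt w}^{(b,e)}u$ means $t$ reduces to $u$ with exactly $b$ $\mathtt{dB}$-steps and $e$ steps of kind $\mathtt{s!}$ or $\mathtt{d!}$. Weakly clash-free normal terms $\mathsf{no}_{\mathtt{wcf}}$ are given by the mutually inductive grammars: $\mathsf{ne}_{\mathtt{wcf}} ::= x \mid \mathsf{ne}_{\mathtt{wcf}}\,\mathsf{na}_{\mathtt{wcf}} \mid \mathrm{der}(\mathsf{ne}_{\mathtt{wcf}}) \mid \mathsf{ne}_{\mathtt{wcf}}[x\backslash\mathsf{ne}_{\mathtt{wcf}}]$; $\mathsf{na}_{\mathtt{wcf}} ::= {!t} \mid \mathsf{ne}_{\mathtt{wcf}} \mid \mathsf{na}_{\mathtt{wcf}}[x\backslash\mathsf{ne}_{\mathtt{wcf}}]$ ($t$ any term); $\mathsf{nb}_{\mathtt{wcf}} ::= \mathsf{ne}_{\mathtt{wcf}} \mid \lambda x.\mathsf{no}_{\mathtt{wcf}} \mid \mathsf{nb}_{\mathtt{wcf}}[x\backslash\mathsf{ne}_{\mathtt{wcf}}]$; $\mathsf{no}_{\mathtt{wcf}} ::= \mathsf{na}_{\mathtt{wcf}}\mid\mathsf{nb}_{\mathtt{wcf}}$. Size: $|x|_{\mathtt w}=0$, $|!t|_{\mathtt w}=0$, $|t\,u|_{\mathtt w}=1+|t|_{\mathtt w}+|u|_{\mathtt w}$, $|\lambda x.t|_{\mathtt w}=1+|t|_{\mathtt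 w}$, $|\mathrm{der}\,t|_{\mathtt w}=1+|t|_{\mathtt w}$, $|t[x\backslash u]|_{\mathtt w}=1+|t|_{\mathtt w}+|u|_{\mathtt w}$. System $\mathcal U$. Types: $\sigma,\tau ::= \alpha \mid M \mid M\to\sigma$, with $\alpha$ in a countably infinite set of base types and $M ::= [\sigma_i]_{i\in I}$ a finite multiset of types ($I$ finite, possibly empty). Typing contexts $\Gamma,\Delta$ map variables to multiset types, all but finitely many to the empty multiset $[\,]$; $\Gamma+\Delta$ is pointwise multiset union; $\Gamma\setminus\!\!\setminus x$ maps $x$ to $[\,]$ and agrees with $\Gamma$ elsewhere; $x:M$ is the context mapping $x$ to $M$ and all others to $[\,]$. Rules: (ax) $x:[\sigma]\vdash x:\sigma$; (es) from $\Gamma\vdash t:\sigma$ and $\Delta\vdash u:\Gamma(x)$ infer $(\Gamma\setminus\!\!\setminus x)+\Delta\vdash t[x\backslash u]:\sigma$; (abs) from $\Gamma\vdash t:\tau$ infer $\Gamma\setminus\!\!\setminus x\vdash\lambda x.t:\Gamma(x)\to\tau$; (app) from $\Gamma\vdash t:M\to\tau$ and $\Delta\vdash u:M$ infer $\Gamma+\Delta\vdash t\,u:\tau$; (bg) from $(\Gamma_i\vdash t:\sigma_i)_{i\in I}$ infer $+_{i\in I}\Gamma_i\vdash{!t}:[\sigma_i]_{i\in I}$ ($I$ finite, possibly empty); (dr) from $\Gamma\vdash t:[\sigma]$ infer $\Gamma\vdash\mathrm{der}\,t:\sigma$. A term is $\mathcal U$-typable if some judgement $\Gamma\vdash t:\sigma$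 is derivable. $\mathtt{sz}(\Phi)$ is the number of rule occurrences in the derivation $\Phi$, not counting occurrences of (bg). -}

module Defs where

open import Data.Fin using (Fin; zero; suc)
open import Data.List using (List; []; _∷_; _++_)
open import Data.List.Relation.Binary.Permutation.Homogeneous using (Permutation)
open import Data.Nat using (ℕ; zero; suc; _+_)
open import Data.Product using (∃-syntax)
open import Data.Vec using (Vec; []; _∷_; replicate; zipWith; _[_]≔_)
open import Data.Vec.Relation.Binary.Pointwise.Inductive using (Pointwise)
open import Function using (_∘_)
open import Relation.Binary.Construct.Closure.ReflexiveTransitive using (Star)

-- Terms modulo α-conversion are well-scoped de Bruijn terms: Term n has its
-- free variables among n given ones.  In ƛ t and in t [ u ] (the explicit
-- substitution t[x\u]) the variable x is index zero of t and is not in scope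
-- in u.

infixr 6 ƛ_
infixl 7 _·_
infixl 8 _[_]
infixr 9 !_

data Term (n : ℕ) : Set where
  `_   : Fin n → Term n
  _·_  : Term n → Term n → Term n
  ƛ_   : Term (suc n) → Term n
  !_   : Term n → Term n
  der  : Term n → Term n
  _[_] : Term (suc n) → Term n → Term n

ext : ∀ {m n} → (Fin m → Fin n) → Fin (suc m) → Fin (suc n)
ext ρ zero    = zero
ext ρ (suc i) = suc (ρ i)

rename : ∀ {m n} → (Fin m → Fin n) → Term m → Term n
rename ρ (` i)     = ` ρ i
rename ρ (t · u)   = rename ρ t · rename ρ u
rename ρ (ƛ t)     = ƛ rename (ext ρ) t
rename ρ (! t)     = ! rename ρ t
rename ρ (der t)   = der (rename ρ t)
rename ρ (t [ u ]) = rename (ext ρ) t [ rename ρ u ]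

exts : ∀ {m n} → (Fin m → Term n) → Fin (suc m) → Term (suc n)
exts σ zero    = ` zero
exts σ (suc i) = rename suc (σ i)

subst : ∀ {m n} → (Fin m → Term n) → Term m → Term n
subst σ (` i)     = σ i
subst σ (t · u)   = subst σ t · subst σ u
subst σ (ƛ t)     = ƛ subst (exts σ) t
subst σ (! t)     = ! subst σ t
subst σ (der t)   = der (subst σ t)
subst σ (t [ u ]) = subst (exts σ) t [ subst σ u ]

-- t ⟪ u ⟫ is the meta-level substitution t{x\u} with x index zero of t.

single : ∀ {n} → Term n → Fin (suc n) → Term n
single u zero    = u
single u (suc i) = ` i

infixl 8 _⟪_⟫

_⟪_⟫ : ∀ {n} → Term (suc n) → Term n → Term n
t ⟪ u ⟫ = subst (single u) t

-- The hole of a context in LCtx n m or WCtx n m lies in scope m, the whole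
-- context in scope n; plugging may capture the m ∸ n variables bound on the
-- way to the hole.

data LCtx : ℕ → ℕ → Set where
  □    : ∀ {n} → LCtx n n
  _[_] : ∀ {n m} → LCtx (suc n) m → Term n → LCtx n m

data WCtx : ℕ → ℕ → Set where
  □     : ∀ {n} → WCtx n n
  _·ˡ_  : ∀ {n m} → WCtx n m → Term n → WCtx n m
  _·ʳ_  : ∀ {n m} → Term n → WCtx n m → WCtx n m
  ƛ_    : ∀ {n m} → WCtx (suc n) m → WCtx n m
  der   : ∀ {n m} → WCtx n m → WCtx n m
  _[_]ˡ : ∀ {n m} → WCtx (suc n) m → Term n → WCtx n m
  _[_]ʳ : ∀ {n m} → Term (suc n) → WCtx n m → WCtx n m

infix 9 _⟨_⟩ᴸ _⟨_⟩ᵂ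

_⟨_⟩ᴸ : ∀ {n m} → LCtx n m → Term m → Term n
□         ⟨ t ⟩ᴸ = t
(L [ u ]) ⟨ t ⟩ᴸ = L ⟨ t ⟩ᴸ [ u ]

_⟨_⟩ᵂ : ∀ {n m} → WCtx n m → Term m → Term n
□          ⟨ t ⟩ᵂ = t
(W ·ˡ u)   ⟨ t ⟩ᵂ = W ⟨ t ⟩ᵂ · u
(u ·ʳ W)   ⟨ t ⟩ᵂ = u · W ⟨ t ⟩ᵂ
(ƛ W)      ⟨ t ⟩ᵂ = ƛ W ⟨ t ⟩ᵂ
der W      ⟨ t ⟩ᵂ = der (W ⟨ t ⟩ᵂ)
(W [ u ]ˡ) ⟨ t ⟩ᵂ = W ⟨ t ⟩ᵂ [ u ]
(u [ W ]ʳ) ⟨ t ⟩ᵂ = u [ W ⟨ t ⟩ᵂ ]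

-- The embedding of the outer scope into the scope of the hole.  Renaming
-- along it is what keeps the variables of a term moved under L from being
-- captured.

wk : ∀ {n m} → LCtx n m → Fin n → Fin m
wk □         = λ i → i
wk (L [ _ ]) = wk L ∘ suc

data Rule : Set where
  dB s! d! : Rule

infix 4 _↦[_]_ _→w[_]_ _→w_ _↠w_ _↠w[_,_]_

data _↦[_]_ {n : ℕ} : Term n → Rule → Term n → Set where
  dB : ∀ {m} (L : LCtx n m) (t : Term (suc m)) (u : Term n) →
       L ⟨ ƛ t ⟩ᴸ · u ↦[ dB ] L ⟨ t [ rename (wk L) u ] ⟩ᴸ
  s! : ∀ {m} (t : Term (suc n)) (L : LCtx n m) (u : Term m) →
       t [ L ⟨ ! u ⟩ᴸ ] ↦[ s! ] L ⟨ rename (ext (wk L)) t ⟪ u ⟫ ⟩ᴸ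
  d! : ∀ {m} (L : LCtx n m) (t : Term m) →
       der (L ⟨ ! t ⟩ᴸ) ↦[ d! ] L ⟨ t ⟩ᴸ

data _→w[_]_ {n : ℕ} : Term n → Rule → Term n → Set where
  step : ∀ {m r} (W : WCtx n m) {t u : Term m} →
         t ↦[ r ] u → W ⟨ t ⟩ᵂ →w[ r ] W ⟨ u ⟩ᵂ

_→w_ : ∀ {n} → Term n → Term n → Set
t →w u = ∃[ r ] t →w[ r ] u

_↠w_ : ∀ {n} → Term n → Term n → Set
_↠w_ = Star _→w_

data _↠w[_,_]_ {n : ℕ} : Term n → ℕ → ℕ → Term n → Set where
  done  : ∀ {t} → t ↠w[ 0 , 0 ] t
  dB-∷  : ∀ {t u v b e} →
          t →w[ dB ] u → u ↠w[ b , e ] v → t ↠w[ suc b , e ] v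
  s!-∷  : ∀ {t u v b e} →
          t →w[ s! ] u → u ↠w[ b , e ] v → t ↠w[ b , suc e ] v
  d!-∷  : ∀ {t u v b e} →
          t →w[ d! ] u → u ↠w[ b , e ] v → t ↠w[ b , suc e ] v

data Ne {n : ℕ} : Term n → Set
data Na {n : ℕ} : Term n → Set
data Nb {n : ℕ} : Term n → Set
data No {n : ℕ} : Term n → Set

data Ne {n} where
  `_   : ∀ i → Ne (` i)
  _·_  : ∀ {t u} → Ne t → Na u → Ne (t · u)
  der  : ∀ {t} → Ne t → Ne (der t)
  _[_] : ∀ {t u} → Ne t → Ne u → Ne (t [ u ])

data Na {n} where
  !_   : ∀ t → Na (! t)
  ne   : ∀ {t} → Ne t → Na t
  _[_] : ∀ {t u} → Na t → Ne u → Na (t [ u ])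

data Nb {n} where
  ne   : ∀ {t} → Ne t → Nb t
  ƛ_   : ∀ {t} → No t → Nb (ƛ t)
  _[_] : ∀ {t u} → Nb t → Ne u → Nb (t [ u ])

data No {n} where
  na : ∀ {t} → Na t → No t
  nb : ∀ {t} → Nb t → No t

∣_∣w : ∀ {n} → Term n → ℕ
∣ ` i ∣w     = 0
∣ t · u ∣w   = 1 + ∣ t ∣w + ∣ u ∣w
∣ ƛ t ∣w     = 1 + ∣ t ∣w
∣ ! t ∣w     = 0
∣ der t ∣w   = 1 + ∣ t ∣w
∣ t [ u ] ∣w = 1 + ∣ t ∣w + ∣ u ∣w

-- A finite multiset is represented by a list of its elements; _≈_ and _≈ᴹ_
-- are the equalities of types and of multisets that this induces, i.e.
-- permutation of the lists at every depth.

infixr 6 _⇒_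
infix 4 _≈_ _≈ᴹ_ _≈ᶜ_

data Type : Set where
  base : ℕ → Type
  mset : List Type → Type
  _⇒_  : List Type → Type → Type

Multiset : Set
Multiset = List Type

data _≈_ : Type → Type → Set where
  base : ∀ a → base a ≈ base a
  mset : ∀ {M N} → Permutation _≈_ M N → mset M ≈ mset N
  _⇒_  : ∀ {M N σ τ} → Permutation _≈_ M N → σ ≈ τ → M ⇒ σ ≈ N ⇒ τ

_≈ᴹ_ : Multiset → Multiset → Set
_≈ᴹ_ = Permutation _≈_

-- A typing context for terms in scope n.  Variables outside the scope are
-- implicitly mapped to the empty multiset: no rule could assign them anything
-- else, as the system has no weakening.

Ctx : ℕ → Set
Ctx n = Vec Multiset n

_≈ᶜ_ : ∀ {n} → Ctx n → Ctx n → Set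
_≈ᶜ_ = Pointwise _≈ᴹ_

∅ : ∀ {n} → Ctx n
∅ {n} = replicate n []

infixl 6 _⊎_

_⊎_ : ∀ {n} → Ctx n → Ctx n → Ctx n
_⊎_ = zipWith _++_

only : ∀ {n} → Fin n → Multiset → Ctx n
only i M = ∅ [ i ]≔ M

-- For Γ of the form M ∷ Γ′ and x index zero, Γ(x) is M and Γ ∖∖ x is Γ′.
--
-- Γ ⊢! t ∶ M packs the premises of (bg): a finite family of derivations
-- Γᵢ ⊢ t ∶ σᵢ with Γ the sum of the Γᵢ and M the multiset of the σᵢ.
--
-- conv is not a rule of the system: it only identifies judgements that are
-- equal once lists are read as multisets, and has no weight in sz.

infix 4 _⊢_∶_ _⊢!_∶_

data _⊢_∶_  {n : ℕ} : Ctx n → Term n → Type → Set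
data _⊢!_∶_ {n : ℕ} : Ctx n → Term n → Multiset → Set

data _⊢_∶_ {n} where
  ax   : ∀ {i σ} → only i (σ ∷ []) ⊢ ` i ∶ σ
  es   : ∀ {M Γ Δ t u σ} →
         M ∷ Γ ⊢ t ∶ σ → Δ ⊢ u ∶ mset M → Γ ⊎ Δ ⊢ t [ u ] ∶ σ
  abs  : ∀ {M Γ t τ} →
         M ∷ Γ ⊢ t ∶ τ → Γ ⊢ ƛ t ∶ M ⇒ τ
  app  : ∀ {M Γ Δ t u τ} →
         Γ ⊢ t ∶ M ⇒ τ → Δ ⊢ u ∶ mset M → Γ ⊎ Δ ⊢ t · u ∶ τ
  bg   : ∀ {M Γ t} →
         Γ ⊢! t ∶ M → Γ ⊢ ! t ∶ mset M
  dr   : ∀ {Γ t σ} →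
         Γ ⊢ t ∶ mset (σ ∷ []) → Γ ⊢ der t ∶ σ
  conv : ∀ {Γ Δ t σ τ} →
         Γ ≈ᶜ Δ → σ ≈ τ → Γ ⊢ t ∶ σ → Δ ⊢ t ∶ τ

data _⊢!_∶_ {n} where
  []  : ∀ {t} → ∅ ⊢! t ∶ []
  _∷_ : ∀ {Γ Δ t σ M} →
        Γ ⊢ t ∶ σ → Δ ⊢! t ∶ M → Γ ⊎ Δ ⊢! t ∶ σ ∷ M

Typable : ∀ {n} → Term n → Set
Typable t = ∃[ Γ ] ∃[ σ ] Γ ⊢ t ∶ σ

sz  : ∀ {n} {Γ : Ctx n} {t σ} → Γ ⊢ t ∶ σ → ℕ
sz! : ∀ {n} {Γ : Ctx n} {t M} → Γ ⊢! t ∶ M → ℕ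

sz ax           = 1
sz (es Φ Ψ)     = 1 + sz Φ + sz Ψ
sz (abs Φ)      = 1 + sz Φ
sz (app Φ Ψ)    = 1 + sz Φ + sz Ψ
sz (bg Φs)      = sz! Φs
sz (dr Φ)       = 1 + sz Φ
sz (conv _ _ Φ) = sz Φ

sz! []       = 0
sz! (Φ ∷ Φs) = sz Φ + sz! Φs

-- A weak redex lies under no !, so a derivation types it exactly once, and
-- contracting it lowers the size of the derivation by at least one.  Hence weak
-- reduction of a typed term stops.  A typed term that does not reduce has no
-- clash, so it lies in no_wcf, and each of its constructors counted by the weak
-- size costs one more rule.  Conversely every term of no_wcf is typable (a
-- neutral term with any type), and typability is preserved backwards along weak
-- reduction because a derivation of t{x\u} splits into one of t and a family of
-- derivations of u.

module Submission where

open import Defs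
open import Algebra.Bundles using (CommutativeMonoid)
import Algebra.Construct.DirectProduct as DirectProduct
open import Algebra.Properties.CommutativeSemigroup using (interchange; x∙yz≈y∙xz; xy∙z≈xz∙y)
open import Data.Empty using (⊥-elim)
open import Data.Fin using (Fin; zero; suc)
open import Data.List using (List; []; _∷_; _++_)
import Data.List.Relation.Binary.Permutation.Homogeneous as Perm
import Data.List.Relation.Binary.Permutation.Setoid.Properties as PermProperties
open import Data.List.Relation.Binary.Pointwise using ([]; _∷_)
  renaming (Pointwise to ListPointwise)
open import Data.Nat using (ℕ; zero; suc; _+_; _≤_; _≥_; z≤n; s≤s)
import Data.Nat.Properties as ℕ
open import Data.Product using (_×_; ∃-syntax; _,_; proj₁; proj₂)
open import Data.Sum using (inj₁; inj₂) renaming (_⊎_ to _⊎′_)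
open import Data.Vec using ([]; _∷_)
import Data.Vec.Relation.Binary.Pointwise.Inductive as VecPointwise
open VecPointwise using ([]; _∷_)
open import Function using (_∘_; id)
open import Function.Bundles using (_⇔_; mk⇔)
open import Relation.Binary using (IsEquivalence; Preorder)
open import Relation.Binary.Construct.Closure.ReflexiveTransitive using (ε; _◅_)
open import Relation.Binary.PropositionalEquality as ≡ using (_≡_; refl)
import Relation.Binary.Reasoning.Preorder as PreorderReasoning
open import Relation.Nullary using (¬_)

-- Multisets and contexts

mutual
  ≈-refl : ∀ {σ} → σ ≈ σ
  ≈-refl {base a} = base a
  ≈-refl {mset M} = mset (Perm.refl ≋-refl)
  ≈-refl {M ⇒ σ}  = Perm.refl ≋-refl ⇒ ≈-refl

  ≋-refl : ∀ {M} → ListPointwise _≈_ M M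
  ≋-refl {[]}    = []
  ≋-refl {_ ∷ _} = ≈-refl ∷ ≋-refl

mutual
  ≈-sym : ∀ {σ τ} → σ ≈ τ → τ ≈ σ
  ≈-sym (base a) = base a
  ≈-sym (mset p) = mset (≈ᴹ-sym p)
  ≈-sym (p ⇒ q)  = ≈ᴹ-sym p ⇒ ≈-sym q

  ≈ᴹ-sym : ∀ {M N} → M ≈ᴹ N → N ≈ᴹ M
  ≈ᴹ-sym (Perm.refl p)     = Perm.refl (≋-sym p)
  ≈ᴹ-sym (Perm.prep e p)   = Perm.prep (≈-sym e) (≈ᴹ-sym p)
  ≈ᴹ-sym (Perm.swap e f p) = Perm.swap (≈-sym f) (≈-sym e) (≈ᴹ-sym p)
  ≈ᴹ-sym (Perm.trans p q)  = Perm.trans (≈ᴹ-sym q) (≈ᴹ-sym p)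

  ≋-sym : ∀ {M N} → ListPointwise _≈_ M N → ListPointwise _≈_ N M
  ≋-sym []      = []
  ≋-sym (e ∷ p) = ≈-sym e ∷ ≋-sym p

≈-trans : ∀ {ρ σ τ} → ρ ≈ σ → σ ≈ τ → ρ ≈ τ
≈-trans (base a) (base .a) = base a
≈-trans (mset p) (mset q)  = mset (Perm.trans p q)
≈-trans (p ⇒ e)  (q ⇒ f)   = Perm.trans p q ⇒ ≈-trans e f

≈-isEquivalence : IsEquivalence _≈_
≈-isEquivalence = record { refl = ≈-refl ; sym = ≈-sym ; trans = ≈-trans }

++-commutativeMonoid : CommutativeMonoid _ _
++-commutativeMonoid =
  PermProperties.++-commutativeMonoid (record { isEquivalence = ≈-isEquivalence })

module ++ = CommutativeMonoid ++-commutativeMonoid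

≈ᴹ-refl : ∀ {M} → M ≈ᴹ M
≈ᴹ-refl = ++.refl

⊎-cong : ∀ {n} {Γ Γ′ Δ Δ′ : Ctx n} → Γ ≈ᶜ Γ′ → Δ ≈ᶜ Δ′ → Γ ⊎ Δ ≈ᶜ Γ′ ⊎ Δ′
⊎-cong []      []      = []
⊎-cong (p ∷ q) (r ∷ s) = ++.∙-cong p r ∷ ⊎-cong q s

⊎-assoc : ∀ {n} (Γ Δ Θ : Ctx n) → Γ ⊎ Δ ⊎ Θ ≈ᶜ Γ ⊎ (Δ ⊎ Θ)
⊎-assoc []      []      []      = []
⊎-assoc (M ∷ Γ) (N ∷ Δ) (O ∷ Θ) = ++.assoc M N O ∷ ⊎-assoc Γ Δ Θ

⊎-comm : ∀ {n} (Γ Δ : Ctx n) → Γ ⊎ Δ ≈ᶜ Δ ⊎ Γ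
⊎-comm []      []      = []
⊎-comm (M ∷ Γ) (N ∷ Δ) = ++.comm M N ∷ ⊎-comm Γ Δ

⊎-identityˡ : ∀ {n} (Γ : Ctx n) → ∅ ⊎ Γ ≈ᶜ Γ
⊎-identityˡ []      = []
⊎-identityˡ (M ∷ Γ) = ++.identityˡ M ∷ ⊎-identityˡ Γ

⊎-identityʳ : ∀ {n} (Γ : Ctx n) → Γ ⊎ ∅ ≈ᶜ Γ
⊎-identityʳ []      = []
⊎-identityʳ (M ∷ Γ) = ++.identityʳ M ∷ ⊎-identityʳ Γ

⊎-commutativeMonoid : ℕ → CommutativeMonoid _ _
⊎-commutativeMonoid n = record
  { Carrier = Ctx n
  ; _≈_     = _≈ᶜ_
  ; _∙_     = _⊎_
  ; ε       = ∅
  ; isCommutativeMonoid = record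
    { isMonoid = record
      { isSemigroup = record
        { isMagma = record
          { isEquivalence = VecPointwise.isEquivalence ++.isEquivalence n
          ; ∙-cong        = ⊎-cong
          }
        ; assoc = ⊎-assoc
        }
      ; identity = ⊎-identityˡ , ⊎-identityʳ
      }
    ; comm = ⊎-comm
    }
  }

module ⊎ {n : ℕ} = CommutativeMonoid (⊎-commutativeMonoid n)

only-cong : ∀ {n} (i : Fin n) {M N} → M ≈ᴹ N → only i M ≈ᶜ only i N
only-cong zero    p = p ∷ ⊎.refl
only-cong (suc i) p = ≈ᴹ-refl ∷ only-cong i p

only-[] : ∀ {n} (i : Fin n) → only i [] ≈ᶜ ∅
only-[] zero    = ⊎.refl
only-[] (suc i) = ≈ᴹ-refl ∷ only-[] i

only-++ : ∀ {n} (i : Fin n) M N → only i (M ++ N) ≈ᶜ only i M ⊎ only i N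
only-++ zero    M N = ≈ᴹ-refl ∷ ⊎.sym (⊎.identityˡ _)
only-++ (suc i) M N = ≈ᴹ-refl ∷ only-++ i M N

-- The direct image of a context: multisets of variables that `ρ` identifies are added up, and
-- variables outside the image of `ρ` get the empty multiset.
push : ∀ {m n} → (Fin m → Fin n) → Ctx m → Ctx n
push ρ []      = ∅
push ρ (M ∷ Γ) = only (ρ zero) M ⊎ push (ρ ∘ suc) Γ

push-cong : ∀ {m n} (ρ : Fin m → Fin n) {Γ Δ} → Γ ≈ᶜ Δ → push ρ Γ ≈ᶜ push ρ Δ
push-cong ρ []      = ⊎.refl
push-cong ρ (p ∷ q) = ⊎-cong (only-cong (ρ zero) p) (push-cong (ρ ∘ suc) q)

push-∅ : ∀ {m n} (ρ : Fin m → Fin n) → push ρ ∅ ≈ᶜ ∅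
push-∅ {zero}  ρ = ⊎.refl
push-∅ {suc m} ρ =
  ⊎.trans (⊎-cong (only-[] (ρ zero)) (push-∅ (ρ ∘ suc))) (⊎.identityˡ ∅)

push-⊎ : ∀ {m n} (ρ : Fin m → Fin n) Γ Δ → push ρ (Γ ⊎ Δ) ≈ᶜ push ρ Γ ⊎ push ρ Δ
push-⊎ ρ []      []      = ⊎.sym (⊎.identityˡ ∅)
push-⊎ ρ (M ∷ Γ) (N ∷ Δ) =
  ⊎.trans (⊎-cong (only-++ (ρ zero) M N) (push-⊎ (ρ ∘ suc) Γ Δ))
    (interchange ⊎.commutativeSemigroup _ _ _ _)

push-only : ∀ {m n} (ρ : Fin m → Fin n) i M → push ρ (only i M) ≈ᶜ only (ρ i) M
push-only ρ zero    M =
  ⊎.trans (⊎-cong ⊎.refl (push-∅ (ρ ∘ suc))) (⊎.identityʳ _)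
push-only ρ (suc i) M =
  ⊎.trans (⊎-cong (only-[] (ρ zero)) (push-only (ρ ∘ suc) i M)) (⊎.identityˡ _)

push-suc : ∀ {m n} (ρ : Fin m → Fin n) Γ → push (suc ∘ ρ) Γ ≈ᶜ [] ∷ push ρ Γ
push-suc ρ []      = ⊎.refl
push-suc ρ (M ∷ Γ) = ⊎-cong ⊎.refl (push-suc (ρ ∘ suc) Γ)

push-ext : ∀ {m n} (ρ : Fin m → Fin n) M Γ → push (ext ρ) (M ∷ Γ) ≈ᶜ M ∷ push ρ Γ
push-ext ρ M Γ =
  ⊎.trans (⊎-cong ⊎.refl (push-suc ρ Γ)) (++.identityʳ M ∷ ⊎.identityˡ _)

push-id : ∀ {n} (Γ : Ctx n) → push id Γ ≈ᶜ Γ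
push-id []      = []
push-id (M ∷ Γ) = ⊎.trans (push-ext id M Γ) (≈ᴹ-refl ∷ push-id Γ)

-- Resources

-- A typing context together with an upper bound on the size of a derivation, so
-- that premises of the form r₁ ⊕ r₂ ⊑ r account for both at once.
Resource : ℕ → Set
Resource n = Ctx n × ℕ

⊕-commutativeMonoid : ℕ → CommutativeMonoid _ _
⊕-commutativeMonoid n =
  DirectProduct.commutativeMonoid (⊎-commutativeMonoid n) ℕ.+-0-commutativeMonoid

module ⊕ {n : ℕ} = CommutativeMonoid (⊕-commutativeMonoid n)
open ⊕ using () renaming (_∙_ to infixl 6 _⊕_; ε to none; _≈_ to infix 4 _≈ᴿ_)

tick : ∀ {n} → Resource n → Resource n
tick (Γ , k) = Γ , suc k

infixr 5 _∷ᴿ_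

_∷ᴿ_ : ∀ {n} → Multiset → Resource n → Resource (suc n)
M ∷ᴿ (Γ , k) = M ∷ Γ , k

infix 4 _⊑_

-- Contexts have to agree, as the system has no weakening; only the size component is a bound and
-- may grow.
record _⊑_ {n} (r s : Resource n) : Set where
  constructor _,_
  field
    ctx  : proj₁ r ≈ᶜ proj₁ s
    size : proj₂ r ≤ proj₂ s

open _⊑_

≈⇒⊑ : ∀ {n} {r s : Resource n} → r ≈ᴿ s → r ⊑ s
≈⇒⊑ (p , refl) = p , ℕ.≤-refl

⊑-refl : ∀ {n} {r : Resource n} → r ⊑ r
⊑-refl = ⊎.refl , ℕ.≤-refl

⊑-trans : ∀ {n} {r s q : Resource n} → r ⊑ s → s ⊑ q → r ⊑ q
⊑-trans (p , q) (p′ , q′) = ⊎.trans p p′ , ℕ.≤-trans q q′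

⊕-mono : ∀ {n} {r r′ s s′ : Resource n} → r ⊑ r′ → s ⊑ s′ → r ⊕ s ⊑ r′ ⊕ s′
⊕-mono (p , q) (p′ , q′) = ⊎-cong p p′ , ℕ.+-mono-≤ q q′

∷ᴿ-mono : ∀ {n M N} {r s : Resource n} → M ≈ᴹ N → r ⊑ s → M ∷ᴿ r ⊑ N ∷ᴿ s
∷ᴿ-mono e (p , q) = (e ∷ p) , q

tick-mono : ∀ {n} {r s : Resource n} → r ⊑ s → tick r ⊑ tick s
tick-mono (p , q) = p , s≤s q

⊑-tick : ∀ {n} {r : Resource n} → r ⊑ tick r
⊑-tick = ⊎.refl , ℕ.n≤1+n _

-- Moving a tick into the left summand is definitional, since `+` recurses on its left argument;
-- only the right summand takes a lemma.
tick-⊕ʳ : ∀ {n} (r s : Resource n) → tick (r ⊕ s) ⊑ r ⊕ tick s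
tick-⊕ʳ (_ , k) (_ , l) = ⊎.refl , ℕ.≤-reflexive (≡.sym (ℕ.+-suc k l))

⊑-preorder : ℕ → Preorder _ _ _
⊑-preorder n = record
  { Carrier = Resource n
  ; _≈_ = _≈ᴿ_
  ; _≲_ = _⊑_
  ; isPreorder = record
    { isEquivalence = ⊕.isEquivalence ; reflexive = ≈⇒⊑ ; trans = ⊑-trans }
  }

⊕-interchange : ∀ {n} (a b c d : Resource n) → (a ⊕ b) ⊕ (c ⊕ d) ≈ᴿ (a ⊕ c) ⊕ (b ⊕ d)
⊕-interchange = interchange ⊕.commutativeSemigroup

module ⊑-Reasoning {n : ℕ} = PreorderReasoning (⊑-preorder n)

-- Multisets of derivations

-- `P` is abstract so that the same splitting and merging lemmas serve both the premises of `bg` and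
-- the derivations substituted for a variable.
data Bag {n} (P : Resource n → Type → Set) : Multiset → Resource n → Set where
  []  : ∀ {r} → none ⊑ r → Bag P [] r
  add : ∀ {r₁ r₂ r σ M} → P r₁ σ → Bag P M r₂ → r₁ ⊕ r₂ ⊑ r → Bag P (σ ∷ M) r

infix 4 _⊩_∶_

-- System 𝒰 with conv absorbed into the side conditions, so that inversion is
-- pattern matching.
data _⊩_∶_ {n} (r : Resource n) : Term n → Type → Set where
  var : ∀ {i σ} → (only i (σ ∷ []) , 1) ⊑ r → r ⊩ ` i ∶ σ
  es  : ∀ {M r₁ r₂ t u σ} → M ∷ᴿ r₁ ⊩ t ∶ σ → r₂ ⊩ u ∶ mset M →
        tick (r₁ ⊕ r₂) ⊑ r → r ⊩ t [ u ] ∶ σ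
  abs : ∀ {M r₁ t τ} → M ∷ᴿ r₁ ⊩ t ∶ τ → tick r₁ ⊑ r → r ⊩ ƛ t ∶ M ⇒ τ
  app : ∀ {M r₁ r₂ t u τ} → r₁ ⊩ t ∶ M ⇒ τ → r₂ ⊩ u ∶ mset M →
        tick (r₁ ⊕ r₂) ⊑ r → r ⊩ t · u ∶ τ
  bg  : ∀ {M N t} → Bag (_⊩ t ∶_) M r → M ≈ᴹ N → r ⊩ ! t ∶ mset N
  dr  : ∀ {r₁ t σ} → r₁ ⊩ t ∶ mset (σ ∷ []) → tick r₁ ⊑ r → r ⊩ der t ∶ σ

Bag-mono : ∀ {n} {P : Resource n → Type → Set} {M r s} → r ⊑ s → Bag P M r → Bag P M s
Bag-mono r⊑s ([] p)      = [] (⊑-trans p r⊑s)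
Bag-mono r⊑s (add x b p) = add x b (⊑-trans p r⊑s)

Bag-≈ᴹ : ∀ {n} {P : Resource n → Type → Set} →
         (∀ {r σ τ} → σ ≈ τ → P r σ → P r τ) →
         ∀ {M N r} → M ≈ᴹ N → Bag P M r → Bag P N r
Bag-≈ᴹ {P = P} P-≈ = go
  where
  go≋ : ∀ {M N r} → ListPointwise _≈_ M N → Bag P M r → Bag P N r
  go≋ []      ([] p)      = [] p
  go≋ (e ∷ q) (add x b p) = add (P-≈ e x) (go≋ q b) p

  go : ∀ {M N r} → M ≈ᴹ N → Bag P M r → Bag P N r
  go (Perm.refl q)     b           = go≋ q b
  go (Perm.prep e q)   (add x b p) = add (P-≈ e x) (go q b) p
  go (Perm.swap e f q) (add {r₁ = r₁} x (add {r₁ = r₂} {r₂ = r₃} y b p) p′) =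
    add (P-≈ f y) (add (P-≈ e x) (go q b) ⊑-refl)
      (begin
        r₂ ⊕ (r₁ ⊕ r₃) ≈⟨ x∙yz≈y∙xz ⊕.commutativeSemigroup r₂ r₁ r₃ ⟩
        r₁ ⊕ (r₂ ⊕ r₃) ∼⟨ ⊕-mono ⊑-refl p ⟩
        _              ∼⟨ p′ ⟩
        _              ∎)
    where open ⊑-Reasoning
  go (Perm.trans q q′) b           = go q′ (go q b)

Bag-++⁻ : ∀ {n} {P : Resource n → Type → Set} M {N r} → Bag P (M ++ N) r →
          ∃[ r₁ ] ∃[ r₂ ] (Bag P M r₁ × Bag P N r₂ × r₁ ⊕ r₂ ⊑ r)
Bag-++⁻ []      b = none , _ , [] ⊑-refl , b , ≈⇒⊑ (⊕.identityˡ _)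
Bag-++⁻ (σ ∷ M) (add {r₁ = r₀} x b p) with Bag-++⁻ M b
... | r₁ , r₂ , b₁ , b₂ , q =
  r₀ ⊕ r₁ , r₂ , add x b₁ ⊑-refl , b₂ ,
  ⊑-trans (≈⇒⊑ (⊕.assoc r₀ r₁ r₂)) (⊑-trans (⊕-mono ⊑-refl q) p)

Bag-++⁺ : ∀ {n} {P : Resource n → Type → Set} {M N r₁ r₂} →
          Bag P M r₁ → Bag P N r₂ → Bag P (M ++ N) (r₁ ⊕ r₂)
Bag-++⁺ {r₂ = s} ([] p)   b′ =
  Bag-mono (⊑-trans (≈⇒⊑ (⊕.sym (⊕.identityˡ s))) (⊕-mono p ⊑-refl)) b′
Bag-++⁺ (add {r₁} {r₂} x b p) b′ =
  add x (Bag-++⁺ b b′)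
    (⊑-trans (≈⇒⊑ (⊕.sym (⊕.assoc r₁ r₂ _))) (⊕-mono p ⊑-refl))

-- What a simultaneous substitution has to supply: for each variable a bag matching the multiset
-- that the context assigns to it, with a single resource accounting for the total.
data Env {n} : ∀ {m} → (Fin m → Resource n → Type → Set) → Ctx m → Resource n → Set₁ where
  []  : ∀ {P r} → none ⊑ r → Env P [] r
  add : ∀ {m P M Γ r₁ r₂ r} → Bag (P zero) M r₁ → Env {m = m} (P ∘ suc) Γ r₂ →
        r₁ ⊕ r₂ ⊑ r → Env P (M ∷ Γ) r

module _ {n : ℕ} where

  Family : ℕ → Set₁
  Family m = Fin m → Resource n → Type → Set

  Env-mono : ∀ {m} {P : Family m} {Γ r s} → r ⊑ s → Env P Γ r → Env P Γ s
  Env-mono r⊑s ([] p)      = [] (⊑-trans p r⊑s)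
  Env-mono r⊑s (add b E p) = add b E (⊑-trans p r⊑s)

  Env-≈ᶜ : ∀ {m} {P : Family m} →
           (∀ i {r σ τ} → σ ≈ τ → P i r σ → P i r τ) →
           ∀ {Γ Δ r} → Γ ≈ᶜ Δ → Env P Γ r → Env P Δ r
  Env-≈ᶜ P-≈ []      ([] p)      = [] p
  Env-≈ᶜ P-≈ (e ∷ q) (add b E p) =
    add (Bag-≈ᴹ (P-≈ zero) e b) (Env-≈ᶜ (P-≈ ∘ suc) q E) p

  Env-⊎⁻ : ∀ {m} {P : Family m} Γ Δ {r} → Env P (Γ ⊎ Δ) r →
           ∃[ r₁ ] ∃[ r₂ ] (Env P Γ r₁ × Env P Δ r₂ × r₁ ⊕ r₂ ⊑ r)
  Env-⊎⁻ []      []      ([] p)      =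
    none , none , [] ⊑-refl , [] ⊑-refl , ⊑-trans (≈⇒⊑ (⊕.identityˡ none)) p
  Env-⊎⁻ (M ∷ Γ) (N ∷ Δ) (add b E p) with Bag-++⁻ M b | Env-⊎⁻ Γ Δ E
  ... | r₁ , r₂ , b₁ , b₂ , q | s₁ , s₂ , E₁ , E₂ , q′ =
    r₁ ⊕ s₁ , r₂ ⊕ s₂ , add b₁ E₁ ⊑-refl , add b₂ E₂ ⊑-refl ,
    (begin
      (r₁ ⊕ s₁) ⊕ (r₂ ⊕ s₂) ≈⟨ ⊕-interchange r₁ s₁ r₂ s₂ ⟩
      (r₁ ⊕ r₂) ⊕ (s₁ ⊕ s₂) ∼⟨ ⊕-mono q q′ ⟩
      _                     ∼⟨ p ⟩
      _                     ∎)
    where open ⊑-Reasoning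

  Env-⊎⁺ : ∀ {m} {P : Family m} {Γ Δ r₁ r₂} →
           Env P Γ r₁ → Env P Δ r₂ → Env P (Γ ⊎ Δ) (r₁ ⊕ r₂)
  Env-⊎⁺ ([] p) ([] q) =
    [] (⊑-trans (≈⇒⊑ (⊕.sym (⊕.identityˡ none))) (⊕-mono p q))
  Env-⊎⁺ (add {r₁ = r₁} {r₂} b E p) (add {r₁ = s₁} {s₂} b′ E′ q) =
    add (Bag-++⁺ b b′) (Env-⊎⁺ E E′)
      (⊑-trans (≈⇒⊑ (⊕-interchange r₁ s₁ r₂ s₂)) (⊕-mono p q))

  Env-∅⁺ : ∀ {m} {P : Family m} → Env P ∅ none
  Env-∅⁺ {zero}  = [] ⊑-refl
  Env-∅⁺ {suc m} = add ([] ⊑-refl) Env-∅⁺ (≈⇒⊑ (⊕.identityˡ none))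

  Env-∅⁻ : ∀ {m} {P : Family m} {r} → Env P ∅ r → none ⊑ r
  Env-∅⁻ {zero}  ([] p)           = p
  Env-∅⁻ {suc m} (add ([] q) E p) =
    ⊑-trans (≈⇒⊑ (⊕.sym (⊕.identityˡ none))) (⊑-trans (⊕-mono q (Env-∅⁻ E)) p)

  Env-only⁺ : ∀ {m} {P : Family m} i {τ r} → P i r τ → Env P (only i (τ ∷ [])) r
  Env-only⁺ zero    x = add (add x ([] ⊑-refl) ⊑-refl) Env-∅⁺
    (≈⇒⊑ (⊕.trans (⊕.identityʳ _) (⊕.identityʳ _)))
  Env-only⁺ (suc i) x = add ([] ⊑-refl) (Env-only⁺ i x) (≈⇒⊑ (⊕.identityˡ _))

  Env-only⁻ : ∀ {m} {P : Family m} i {τ r} → Env P (only i (τ ∷ [])) r →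
              ∃[ r′ ] (P i r′ τ × r′ ⊑ r)
  Env-only⁻ zero (add (add {r₁ = r′} x ([] q) q′) E p) = r′ , x , (begin
    r′                 ≈⟨ ⊕.trans (⊕.identityʳ _) (⊕.identityʳ r′) ⟨
    r′ ⊕ none ⊕ none   ∼⟨ ⊕-mono (⊕-mono ⊑-refl q) (Env-∅⁻ E) ⟩
    _                  ∼⟨ ⊕-mono q′ ⊑-refl ⟩
    _                  ∼⟨ p ⟩
    _                  ∎)
    where open ⊑-Reasoning
  Env-only⁻ (suc i) (add ([] q) E p) with Env-only⁻ i E
  ... | r′ , x , q′ = r′ , x ,
    ⊑-trans (≈⇒⊑ (⊕.sym (⊕.identityˡ r′))) (⊑-trans (⊕-mono q q′) p)

-- Renaming and substitution

⊩-mono : ∀ {n} {r s : Resource n} {t τ} → r ⊑ s → r ⊩ t ∶ τ → s ⊩ t ∶ τ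
⊩-mono p (var q)    = var (⊑-trans q p)
⊩-mono p (es d e q) = es d e (⊑-trans q p)
⊩-mono p (abs d q)  = abs d (⊑-trans q p)
⊩-mono p (app d e q) = app d e (⊑-trans q p)
⊩-mono p (bg b e)   = bg (Bag-mono p b) e
⊩-mono p (dr d q)   = dr d (⊑-trans q p)

-- The conversion travels up the derivation: an axiom absorbs it in its context, `bg` in its stored
-- permutation, and `abs` passes the argument part to the context of its premise.
⊩-≈ : ∀ {n} {r : Resource n} {t σ τ} → σ ≈ τ → r ⊩ t ∶ σ → r ⊩ t ∶ τ
⊩-≈ e         (var {i} (p , q)) =
  var (⊎.trans (only-cong i (Perm.prep (≈-sym e) ≈ᴹ-refl)) p , q)
⊩-≈ e         (es d d′ q)  = es (⊩-≈ e d) d′ q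
⊩-≈ (p ⇒ e)   (abs d q)    = abs (⊩-≈ e (⊩-mono (∷ᴿ-mono p ⊑-refl) d)) q
⊩-≈ e         (app d d′ q) = app (⊩-≈ (≈ᴹ-refl ⇒ e) d) d′ q
⊩-≈ (mset p)  (bg b e)     = bg b (Perm.trans e p)
⊩-≈ e         (dr d q)     = dr (⊩-≈ (mset (Perm.prep e ≈ᴹ-refl)) d) q

bag : ∀ {n} {r : Resource n} {t M} → r ⊩ ! t ∶ mset M → Bag (_⊩ t ∶_) M r
bag (bg b e) = Bag-≈ᴹ ⊩-≈ e b

pushᴿ : ∀ {m n} → (Fin m → Fin n) → Resource m → Resource n
pushᴿ ρ (Γ , k) = push ρ Γ , k

module _ {m n : ℕ} (ρ : Fin m → Fin n) where

  pushᴿ-mono : ∀ {r s} → r ⊑ s → pushᴿ ρ r ⊑ pushᴿ ρ s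
  pushᴿ-mono (p , q) = push-cong ρ p , q

  pushᴿ-⊕ : ∀ r s → pushᴿ ρ (r ⊕ s) ≈ᴿ pushᴿ ρ r ⊕ pushᴿ ρ s
  pushᴿ-⊕ (Γ , _) (Δ , _) = push-⊎ ρ Γ Δ , refl

  pushᴿ-none : pushᴿ ρ none ≈ᴿ none
  pushᴿ-none = push-∅ ρ , refl

  pushᴿ-⊑ : ∀ r s {q} → r ⊕ s ⊑ q → pushᴿ ρ r ⊕ pushᴿ ρ s ⊑ pushᴿ ρ q
  pushᴿ-⊑ r s p = ⊑-trans (≈⇒⊑ (⊕.sym (pushᴿ-⊕ r s))) (pushᴿ-mono p)

  pushᴿ-⊑-tick : ∀ r s {q} → tick (r ⊕ s) ⊑ q → tick (pushᴿ ρ r ⊕ pushᴿ ρ s) ⊑ pushᴿ ρ q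
  pushᴿ-⊑-tick r s = pushᴿ-⊑ (tick r) s

  ⊑-pushᴿ : ∀ r s {r′ s′ q} → pushᴿ ρ r ⊑ r′ → pushᴿ ρ s ⊑ s′ → r′ ⊕ s′ ⊑ q →
            pushᴿ ρ (r ⊕ s) ⊑ q
  ⊑-pushᴿ r s p p′ q =
    ⊑-trans (≈⇒⊑ (pushᴿ-⊕ r s)) (⊑-trans (⊕-mono p p′) q)

  module _ {P : Resource m → Type → Set} {Q : Resource n → Type → Set} where

    Bag-push⁺ : (∀ {r τ} → P r τ → Q (pushᴿ ρ r) τ) →
                ∀ {M r} → Bag P M r → Bag Q M (pushᴿ ρ r)
    Bag-push⁺ f ([] p)      = [] (⊑-trans (≈⇒⊑ (⊕.sym pushᴿ-none)) (pushᴿ-mono p))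
    Bag-push⁺ f (add {r₁} {r₂} x b p) = add (f x) (Bag-push⁺ f b) (pushᴿ-⊑ r₁ r₂ p)

    Bag-push⁻ : (∀ {r τ} → Q r τ → ∃[ q ] (P q τ × pushᴿ ρ q ⊑ r)) →
                ∀ {M r} → Bag Q M r → ∃[ q ] (Bag P M q × pushᴿ ρ q ⊑ r)
    Bag-push⁻ f ([] p)      = none , [] ⊑-refl , ⊑-trans (≈⇒⊑ pushᴿ-none) p
    Bag-push⁻ f (add x b p) with f x | Bag-push⁻ f b
    ... | q₁ , y , p₁ | q₂ , c , p₂ = q₁ ⊕ q₂ , add y c ⊑-refl , ⊑-pushᴿ q₁ q₂ p₁ p₂ p

  Env-push⁺ : ∀ {l} {P : Fin l → Resource m → Type → Set} {Q : Fin l → Resource n → Type → Set} →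
              (∀ i {r τ} → P i r τ → Q i (pushᴿ ρ r) τ) →
              ∀ {Γ r} → Env P Γ r → Env Q Γ (pushᴿ ρ r)
  Env-push⁺ f ([] p)      = [] (⊑-trans (≈⇒⊑ (⊕.sym pushᴿ-none)) (pushᴿ-mono p))
  Env-push⁺ f (add {r₁ = r₁} {r₂} b E p) = add (Bag-push⁺ (f zero) b) 
    (Env-push⁺ (f ∘ suc) E) (pushᴿ-⊑ r₁ r₂ p)

  Env-push⁻ : ∀ {l} {P : Fin l → Resource m → Type → Set} {Q : Fin l → Resource n → Type → Set} →
              (∀ i {r τ} → Q i r τ → ∃[ q ] (P i q τ × pushᴿ ρ q ⊑ r)) →
              ∀ {Γ r} → Env Q Γ r → ∃[ q ] (Env P Γ q × pushᴿ ρ q ⊑ r)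
  Env-push⁻ f ([] p)      = none , [] ⊑-refl , ⊑-trans (≈⇒⊑ pushᴿ-none) p
  Env-push⁻ f (add b E p) with Bag-push⁻ (f zero) b | Env-push⁻ (f ∘ suc) E
  ... | q₁ , c , p₁ | q₂ , F , p₂ = q₁ ⊕ q₂ , add c F ⊑-refl , ⊑-pushᴿ q₁ q₂ p₁ p₂ p

pushᴿ-ext : ∀ {m n} (ρ : Fin m → Fin n) M r → pushᴿ (ext ρ) (M ∷ᴿ r) ≈ᴿ M ∷ᴿ pushᴿ ρ r
pushᴿ-ext ρ M (Γ , _) = push-ext ρ M Γ , refl

rename⁺ : ∀ {m n} (ρ : Fin m → Fin n) t {r τ} → r ⊩ t ∶ τ → pushᴿ ρ r ⊩ rename ρ t ∶ τ
rename⁺ ρ (` i)     (var p)     =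
  var (⊑-trans (≈⇒⊑ (⊎.sym (push-only ρ i _) , refl)) (pushᴿ-mono ρ p))
rename⁺ ρ (t · u)   (app {r₁ = r₁} {r₂} d e p) =
  app (rename⁺ ρ t d) (rename⁺ ρ u e) (pushᴿ-⊑-tick ρ r₁ r₂ p)
rename⁺ ρ (ƛ t)     (abs {M} {r} d p) =
  abs (⊩-mono (≈⇒⊑ (pushᴿ-ext ρ M r)) (rename⁺ (ext ρ) t d)) (pushᴿ-mono ρ p)
rename⁺ ρ (! t)     (bg b e)    = bg (Bag-push⁺ ρ (rename⁺ ρ t) b) e
rename⁺ ρ (der t)   (dr d p)    = dr (rename⁺ ρ t d) (pushᴿ-mono ρ p)
rename⁺ ρ (t [ u ]) (es {M} {r₁} {r₂} d e p) =
  es (⊩-mono (≈⇒⊑ (pushᴿ-ext ρ M r₁)) (rename⁺ (ext ρ) t d)) (rename⁺ ρ u e)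
    (pushᴿ-⊑-tick ρ r₁ r₂ p)

-- `ext ρ` sends index zero, and nothing else, to index zero, so the multiset of the bound variable
-- can be split off from the image.
⊑-∷ᴿ⁻ : ∀ {m n} (ρ : Fin m → Fin n) {q M r} → pushᴿ (ext ρ) q ⊑ M ∷ᴿ r →
        ∃[ q′ ] (q ⊑ M ∷ᴿ q′ × pushᴿ ρ q′ ⊑ r)
⊑-∷ᴿ⁻ ρ {N ∷ Γ , k} (p , l) with ⊎.trans (⊎.sym (push-ext ρ N Γ)) p
... | e ∷ p′ = (Γ , k) , (e ∷ ⊎.refl , ℕ.≤-refl) , (p′ , l)

-- As `ρ` may identify variables, the context of the renamed term does not determine one for `t`;
-- `q` is rebuilt from the axioms of the derivation.
rename⁻ : ∀ {m n} (ρ : Fin m → Fin n) t {r τ} → r ⊩ rename ρ t ∶ τ →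
          ∃[ q ] (q ⊩ t ∶ τ × pushᴿ ρ q ⊑ r)
rename⁻ ρ (` i)     (var p)     =
  _ , var ⊑-refl , ⊑-trans (≈⇒⊑ (push-only ρ i _ , refl)) p
rename⁻ ρ (t · u)   (app {r₁ = r₁} d e p) with rename⁻ ρ t d | rename⁻ ρ u e
... | q₁ , d′ , p₁ | q₂ , e′ , p₂ =
  tick (q₁ ⊕ q₂) , app d′ e′ ⊑-refl , ⊑-pushᴿ ρ (tick q₁) q₂ (tick-mono p₁) p₂ p
rename⁻ ρ (ƛ t)     (abs d p) with rename⁻ (ext ρ) t d
... | q , d′ , p′ with ⊑-∷ᴿ⁻ ρ p′
... | q′ , p₁ , p₂ =
  tick q′ , abs (⊩-mono p₁ d′) ⊑-refl , ⊑-trans (tick-mono p₂) p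
rename⁻ ρ (! t)     (bg b e) with Bag-push⁻ ρ (rename⁻ ρ t) b
... | q , b′ , p = q , bg b′ e , p
rename⁻ ρ (der t)   (dr d p) with rename⁻ ρ t d
... | q , d′ , p′ = tick q , dr d′ ⊑-refl , ⊑-trans (tick-mono p′) p
rename⁻ ρ (t [ u ]) (es {M} {r₁} {r₂} d e p) with rename⁻ (ext ρ) t d | rename⁻ ρ u e
... | q , d′ , p′ | q₂ , e′ , p₂ with ⊑-∷ᴿ⁻ ρ p′
... | q₁ , p₀ , p₁ =
  tick (q₁ ⊕ q₂) , es (⊩-mono p₀ d′) e′ ⊑-refl ,
  ⊑-pushᴿ ρ (tick q₁) q₂ (tick-mono p₁) p₂ p

-- The tick pays for the axiom that a derivation of σ i replaces.
Item : ∀ {m n} → (Fin m → Term n) → Fin m → Resource n → Type → Set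
Item σ i r τ = tick r ⊩ σ i ∶ τ

Item-≈ᶜ : ∀ {m n} {σ : Fin m → Term n} {Γ Δ r} →
          Γ ≈ᶜ Δ → Env (Item σ) Γ r → Env (Item σ) Δ r
Item-≈ᶜ = Env-≈ᶜ (λ _ → ⊩-≈)

module _ {n : ℕ} (i : Fin n) where

  -- Replacing an axiom by an axiom is free: the tick of each item pays for it, hence the size 0.
  vars⁺ : ∀ M → Bag (λ r τ → tick r ⊩ ` i ∶ τ) M (only i M , 0)
  vars⁺ []      = [] (⊎.sym (only-[] i) , z≤n)
  vars⁺ (τ ∷ M) = add (var ⊑-refl) (vars⁺ M) (⊎.sym (only-++ i (τ ∷ []) M) , z≤n)

  vars⁻ : ∀ {M r} → Bag (λ r τ → tick r ⊩ ` i ∶ τ) M r → (only i M , 0) ⊑ r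
  vars⁻ ([] p)                           = ⊎.trans (only-[] i) (ctx p) , z≤n
  vars⁻ {τ ∷ M} (add (var (q , _)) b p) =
    ⊎.trans (only-++ i (τ ∷ []) M) (⊎.trans (⊎-cong q (ctx (vars⁻ b))) (ctx p)) , z≤n

identity⁺ : ∀ {m n} (ρ : Fin m → Fin n) Γ → Env (Item (`_ ∘ ρ)) Γ (push ρ Γ , 0)
identity⁺ ρ []      = [] ⊑-refl
identity⁺ ρ (M ∷ Γ) = add (vars⁺ (ρ zero) M) (identity⁺ (ρ ∘ suc) Γ) ⊑-refl

identity⁻ : ∀ {m n} (ρ : Fin m → Fin n) {Γ r} → Env (Item (`_ ∘ ρ)) Γ r → (push ρ Γ , 0) ⊑ r
identity⁻ ρ ([] p)      = ctx p , z≤n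
identity⁻ ρ (add b E p) =
  ⊑-trans (⊕-mono (vars⁻ (ρ zero) b) (identity⁻ (ρ ∘ suc) E)) p

exts⁺ : ∀ {m n} {σ : Fin m → Term n} {M Γ s} →
        Env (Item σ) Γ s → Env (Item (exts σ)) (M ∷ Γ) (M ∷ᴿ s)
exts⁺ {σ = σ} {M} {s = Δ , _} E =
  add (vars⁺ zero M) (Env-push⁺ suc (λ i → rename⁺ suc (σ i)) E)
    -- Unfolded, `push id (M ∷ Δ)` is the sum of `only zero M` and `push suc Δ`, the contexts of the
    -- two parts of the environment.
    (push-id (M ∷ Δ) , ℕ.≤-refl)

-- The derivations for the other variables are renamed along `suc` and leave index zero alone, so
-- `M` comes entirely from the axioms for `zero`, whose types form `N`.
exts⁻ : ∀ {m n} {σ : Fin m → Term n} {M N Γ s} →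
        Env (Item (exts σ)) (N ∷ Γ) (M ∷ᴿ s) → N ≈ᴹ M × Env (Item σ) Γ s
exts⁻ {σ = σ} {N = N} (add b E p)
  -- `rename⁻` bounds the size of `q` by one more than that of the given resource. Replacing it by
  -- the size of that resource, with the excess left to the tick, makes an item again.
  with Env-push⁻ suc (λ i x → let q , y , p = rename⁻ suc (σ i) x in
                              (proj₁ q , _) , ⊩-mono (⊎.refl , size p) y , (ctx p , ℕ.≤-refl)) E
... | (Δ , _) , F , p′ with ⊑-trans (⊕-mono (vars⁻ zero b) p′) p
... | q , l with ⊎.trans (⊎.sym (push-id (N ∷ Δ))) q
... | e ∷ q′ = e , Env-mono (q′ , l) F

-- After substitution the whole context stems from the environment; the derivation substituted into
-- contributes only its size.
cost : ∀ {m n} → Resource m → Resource n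
cost (_ , k) = ∅ , k

-- The tick of a rule can ride on `r₁`, so one statement distributes the environment over the
-- premises of `app` and `es` and over the members of a bag.
subst-⊕ : ∀ {m n} {σ : Fin m → Term n} r₁ r₂ {r s} → r₁ ⊕ r₂ ⊑ r → Env (Item σ) (proj₁ r) s →
          ∃[ s₁ ] ∃[ s₂ ] (Env (Item σ) (proj₁ r₁) s₁ × Env (Item σ) (proj₁ r₂) s₂ ×
            (cost r₁ ⊕ s₁) ⊕ (cost r₂ ⊕ s₂) ⊑ cost r ⊕ s)
subst-⊕ r₁ r₂ p E with Env-⊎⁻ (proj₁ r₁) (proj₁ r₂) (Item-≈ᶜ (⊎.sym (ctx p)) E)
... | s₁ , s₂ , E₁ , E₂ , q = s₁ , s₂ , E₁ , E₂ ,
  ⊑-trans (≈⇒⊑ (⊕-interchange (cost r₁) s₁ (cost r₂) s₂))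
    (⊕-mono (⊎.identityˡ ∅ , size p) q)

cost-mono : ∀ {m n} {r r′ : Resource m} {s : Resource n} → r ⊑ r′ → cost r ⊕ s ⊑ cost r′ ⊕ s
cost-mono p = ⊕-mono (⊎.refl , size p) ⊑-refl

-- Substitution is simultaneous so that the induction passes binders. Each axiom, of size 1, gives
-- way to a derivation that exceeds its share of `s` by at most this 1, so the sizes simply add.
subst⁺ : ∀ {m n} (σ : Fin m → Term n) t {r s τ} →
         r ⊩ t ∶ τ → Env (Item σ) (proj₁ r) s → cost r ⊕ s ⊩ subst σ t ∶ τ
subst⁺ σ (` i) (var p) E with Env-only⁻ i (Item-≈ᶜ (⊎.sym (ctx p)) E)
... | s , x , q = ⊩-mono (⊑-trans (⊎.sym (⊎.identityˡ _) , ℕ.≤-refl)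
                                  (⊕-mono (⊎.refl , size p) q)) x
subst⁺ σ (t · u) (app {r₁ = r₁} {r₂} d e p) E with subst-⊕ (tick r₁) r₂ p E
... | s₁ , s₂ , E₁ , E₂ , q = app (subst⁺ σ t d E₁) (subst⁺ σ u e E₂) q
subst⁺ σ (ƛ t) (abs {M} {r₁} d p) E =
  abs (subst⁺ (exts σ) t d (exts⁺ (Item-≈ᶜ (⊎.sym (ctx p)) E))) (cost-mono p)
subst⁺ σ (! t) (bg b e) E = bg (go b E) e
  where
  go : ∀ {r s M} → Bag (_⊩ t ∶_) M r → Env (Item σ) (proj₁ r) s →
       Bag (_⊩ subst σ t ∶_) M (cost r ⊕ s)
  go ([] p) E = [] (⊑-trans (≈⇒⊑ (⊕.sym (⊕.identityˡ none)))
                     (⊕-mono (⊎.refl , z≤n) (Env-∅⁻ (Item-≈ᶜ (⊎.sym (ctx p)) E))))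
  go (add {r₁} {r₂} d b p) E with subst-⊕ r₁ r₂ p E
  ... | s₁ , s₂ , E₁ , E₂ , q = add (subst⁺ σ t d E₁) (go b E₂) q
subst⁺ σ (der t) (dr d p) E =
  dr (subst⁺ σ t d (Item-≈ᶜ (⊎.sym (ctx p)) E)) (cost-mono p)
subst⁺ σ (t [ u ]) (es {M} {r₁} {r₂} d e p) E with subst-⊕ (tick r₁) r₂ p E
... | s₁ , s₂ , E₁ , E₂ , q = es (subst⁺ (exts σ) t d (exts⁺ E₁)) (subst⁺ σ u e E₂) q

-- Recursion on `t` cuts the derivation at the variables of `t`: the part that types some `σ i` goes
-- into the environment, the rest types `t` with axioms in place of the removed parts. The size of
-- `q` is left open, as expansion tracks only contexts.
subst⁻ : ∀ {m n} (σ : Fin m → Term n) t {r τ} → r ⊩ subst σ t ∶ τ →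
         ∃[ q ] (q ⊩ t ∶ τ × Env (Item σ) (proj₁ q) r)
subst⁻ σ (` i) d = _ , var ⊑-refl , Env-only⁺ i (⊩-mono ⊑-tick d)
subst⁻ σ (t · u) (app d e p) with subst⁻ σ t d | subst⁻ σ u e
... | q₁ , d′ , E₁ | q₂ , e′ , E₂ =
  tick (q₁ ⊕ q₂) , app d′ e′ ⊑-refl , Env-mono (⊑-trans ⊑-tick p) (Env-⊎⁺ E₁ E₂)
subst⁻ σ (ƛ t) (abs d p) with subst⁻ (exts σ) t d
... | (N ∷ Γ , k) , d′ , E with exts⁻ E
... | e , F = tick (Γ , k) , abs (⊩-mono (∷ᴿ-mono e ⊑-refl) d′) ⊑-refl ,
  Env-mono (⊑-trans ⊑-tick p) F
subst⁻ σ (! t) (bg b e) with go b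
  where
  go : ∀ {r M} → Bag (_⊩ subst σ t ∶_) M r →
       ∃[ q ] (Bag (_⊩ t ∶_) M q × Env (Item σ) (proj₁ q) r)
  go ([] p) = none , [] ⊑-refl , Env-mono p Env-∅⁺
  go (add d b p) with subst⁻ σ t d | go b
  ... | q₁ , d′ , E₁ | q₂ , b′ , E₂ =
    q₁ ⊕ q₂ , add d′ b′ ⊑-refl , Env-mono p (Env-⊎⁺ E₁ E₂)
... | q , b′ , E = q , bg b′ e , E
subst⁻ σ (der t) (dr d p) with subst⁻ σ t d
... | q , d′ , E = tick q , dr d′ ⊑-refl , Env-mono (⊑-trans ⊑-tick p) E
subst⁻ σ (t [ u ]) (es d e p) with subst⁻ (exts σ) t d | subst⁻ σ u e
... | (N ∷ Γ , k) , d′ , E | q₂ , e′ , E₂ with exts⁻ E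
... | f , E₁ = tick ((Γ , k) ⊕ q₂) , es (⊩-mono (∷ᴿ-mono f ⊑-refl) d′) e′ ⊑-refl ,
  Env-mono (⊑-trans ⊑-tick p) (Env-⊎⁺ E₁ E₂)

single⁺ : ∀ {n} {u : Term n} {M s} → Bag (_⊩ u ∶_) M s →
          ∀ Γ → Env (Item (single u)) (M ∷ Γ) (s ⊕ (Γ , 0))
single⁺ b Γ = add (go b) (identity⁺ id Γ) (⊕-mono ⊑-refl (push-id Γ , z≤n))
  where
  go : ∀ {n} {u : Term n} {M s} → Bag (_⊩ u ∶_) M s → Bag (λ r τ → tick r ⊩ u ∶ τ) M s
  go ([] p)      = [] p
  go (add d b p) = add (⊩-mono ⊑-tick d) (go b) p

single⁻ : ∀ {n} {u : Term n} {M Γ r} → Env (Item (single u)) (M ∷ Γ) r →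
          ∃[ s ] (Bag (_⊩ u ∶_) M s × proj₁ r ≈ᶜ proj₁ s ⊎ Γ)
single⁻ {Γ = Γ} (add b E p) with go b
  where
  go : ∀ {n} {u : Term n} {M s} → Bag (λ r τ → tick r ⊩ u ∶ τ) M s →
       ∃[ k ] Bag (_⊩ u ∶_) M (proj₁ s , k)
  go ([] p)      = 0 , [] (ctx p , z≤n)
  go (add d b p) with go b
  ... | _ , b′ = _ , add d b′ (ctx p , ℕ.≤-refl)
... | k , b′ = _ , b′ , ⊎.sym (⊎.trans
  (⊎-cong ⊎.refl (⊎.trans (⊎.sym (push-id Γ)) (ctx (identity⁻ id E)))) (ctx p))

-- Reduction and expansion

infix 4 _⊩ᴸ_▹_

-- Plugging a term typed with s into L yields one typed with r, at any type.
data _⊩ᴸ_▹_ {n} (r : Resource n) : ∀ {m} → LCtx n m → Resource m → Set where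
  □  : ∀ {s} → s ⊑ r → r ⊩ᴸ □ ▹ s
  es : ∀ {m M r₁ r₂} {L : LCtx (suc n) m} {u s} → M ∷ᴿ r₁ ⊩ᴸ L ▹ s → r₂ ⊩ u ∶ mset M →
       tick (r₁ ⊕ r₂) ⊑ r → r ⊩ᴸ L [ u ] ▹ s

⊩ᴸ-mono : ∀ {n m} {L : LCtx n m} {r r′ s s′} →
          r ⊑ r′ → s′ ⊑ s → r ⊩ᴸ L ▹ s → r′ ⊩ᴸ L ▹ s′
⊩ᴸ-mono p q (□ l)      = □ (⊑-trans q (⊑-trans l p))
⊩ᴸ-mono p q (es d e l) = es (⊩ᴸ-mono ⊑-refl q d) e (⊑-trans l p)

plug⁺ : ∀ {n m} {L : LCtx n m} {r s t τ} → r ⊩ᴸ L ▹ s → s ⊩ t ∶ τ → r ⊩ L ⟨ t ⟩ᴸ ∶ τ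
plug⁺ (□ p)      d = ⊩-mono p d
plug⁺ (es l e p) d = es (plug⁺ l d) e p

plug⁻ : ∀ {n m} (L : LCtx n m) {r t τ} → r ⊩ L ⟨ t ⟩ᴸ ∶ τ → ∃[ s ] (r ⊩ᴸ L ▹ s × s ⊩ t ∶ τ)
plug⁻ □       d          = _ , □ ⊑-refl , d
plug⁻ (L [ u ]) (es d e p) with plug⁻ L d
... | s , l , d′ = s , es l e p , d′

push-wk : ∀ {n m} (L : LCtx (suc n) m) Θ → push (wk L) ([] ∷ Θ) ≈ᶜ push (wk L ∘ suc) Θ
push-wk L Θ = ⊎.trans (⊎-cong (only-[] _) ⊎.refl) (⊎.identityˡ _)

-- The frame property behind moving a term under `L`. Each layer of `L` types the hole exactly once,
-- and a resource renamed along `wk L` gives nothing to the variables that `L` binds, so it reaches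
-- the outside unchanged.
frame⁺ : ∀ {n m} {L : LCtx n m} {r s} q → r ⊩ᴸ L ▹ s → r ⊕ q ⊩ᴸ L ▹ s ⊕ pushᴿ (wk L) q
frame⁺ q (□ p) = □ (⊕-mono p (push-id (proj₁ q) , ℕ.≤-refl))
frame⁺ {L = L [ _ ]} {r} q (es {M = M} {r₁} {r₂} {s = s} l e p) =
  es (⊩ᴸ-mono (∷ᴿ-mono (++.identityʳ M) ⊑-refl)
        (⊕-mono (⊑-refl {r = s}) (⊎.sym (push-wk L (proj₁ q)) , ℕ.≤-refl))
        (frame⁺ ([] ∷ᴿ q) l)) e
    (begin
      tick ((r₁ ⊕ q) ⊕ r₂) ≈⟨ xy∙z≈xz∙y ⊕.commutativeSemigroup (tick r₁) q r₂ ⟩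
      tick (r₁ ⊕ r₂) ⊕ q   ∼⟨ ⊕-mono p ⊑-refl ⟩
      r ⊕ q                ∎)
  where open ⊑-Reasoning

-- Takes out of the hole what `frame⁺` puts in. The size `k` at the hole is free because expansion
-- plugs in a different term there.
frame⁻ : ∀ {n m} {L : LCtx n m} {r s Δ} Θ → r ⊩ᴸ L ▹ s → proj₁ s ≈ᶜ Δ ⊎ push (wk L) Θ →
         ∀ k → ∃[ q ] (q ⊩ᴸ L ▹ (Δ , k) × proj₁ r ≈ᶜ proj₁ q ⊎ Θ)
frame⁻ Θ (□ p) e k = _ , □ ⊑-refl ,
  ⊎.trans (⊎.sym (ctx p)) (⊎.trans e (⊎-cong ⊎.refl (push-id Θ)))
frame⁻ {L = L [ _ ]} Θ (es {r₂ = r₂} l d p) e k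
  with frame⁻ ([] ∷ Θ) l (⊎.trans e (⊎-cong ⊎.refl (⊎.sym (push-wk L Θ)))) k
... | ((N ∷ Γ , j) , l′ , f ∷ g) =
  tick ((Γ , j) ⊕ r₂) ,
  -- The framed part is empty at the variable bound here, so its multiset is unchanged up to a
  -- trailing `[]`.
  es l′ (⊩-≈ (mset (++.trans f (++.identityʳ N))) d) ⊑-refl ,
  ⊎.trans (⊎.sym (ctx p)) (⊎.trans (⊎-cong g ⊎.refl)
    (xy∙z≈xz∙y ⊎.commutativeSemigroup Γ Θ (proj₁ r₂)))

-- Each redex gives up one counted rule: `dB` trades an `app` and an `abs` for an `es`, `s!` loses
-- its `es`, and `d!` its `dr`. The `bg` that disappears weighs nothing.
↦-reduction : ∀ {n} {t u : Term n} {a r τ} → t ↦[ a ] u → r ⊩ t ∶ τ →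
              ∃[ r′ ] (r′ ⊩ u ∶ τ × tick r′ ⊑ r)
↦-reduction (dB L t u) (app {r₂ = r₂} d e p) with plug⁻ L d
... | s , l , abs {r₁ = s₁} d′ q =
  _ , plug⁺ (frame⁺ r₂ l) (es d′ (rename⁺ (wk L) u e) (⊕-mono q ⊑-refl)) , p
↦-reduction (s! t L u) (es {M} {r₁} {r₂} d e p) with plug⁻ L e
... | s , l , d′ =
  -- The list context typed within `r₂` now stands outside, and the body with `r₁` is framed into
  -- it.
  r₂ ⊕ r₁ ,
  plug⁺ (frame⁺ r₁ l)
    (⊩-mono
      (⊎.identityˡ _ ,
       ℕ.≤-reflexive (≡.trans (ℕ.+-comm (proj₂ r₁) _) (≡.cong (_+ proj₂ r₁) (ℕ.+-identityʳ _))))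
      (subst⁺ (single u) (rename (ext (wk L)) t)
        (⊩-mono (≈⇒⊑ (pushᴿ-ext (wk L) M r₁)) (rename⁺ (ext (wk L)) t d))
        (single⁺ (bag d′) (push (wk L) (proj₁ r₁))))) ,
  ⊑-trans (tick-mono (≈⇒⊑ (⊕.comm r₂ r₁))) p
↦-reduction (d! L t) (dr d p) with plug⁻ L d
... | s , l , e with bag e
-- The premise of `dr` has a singleton multiset type, so exactly one derivation lies under the `!`.
... | add d′ ([] q) q′ =
  _ , plug⁺ l (⊩-mono (⊑-trans (≈⇒⊑ (⊕.sym (⊕.identityʳ _)))
                         (⊑-trans (⊕-mono ⊑-refl q) q′)) d′) , p

→w-reduction : ∀ {n} {t u : Term n} {a r τ} → t →w[ a ] u → r ⊩ t ∶ τ →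
               ∃[ r′ ] (r′ ⊩ u ∶ τ × tick r′ ⊑ r)
→w-reduction (step W x) = go W
  where
  go : ∀ {n} (W : WCtx n _) {r τ} → r ⊩ W ⟨ _ ⟩ᵂ ∶ τ → ∃[ r′ ] (r′ ⊩ W ⟨ _ ⟩ᵂ ∶ τ × tick r′ ⊑ r)
  go □          d = ↦-reduction x d
  go (W ·ˡ u) (app {r₂ = r₂} d e p) with go W d
  ... | r′ , d′ , q = _ , app d′ e ⊑-refl , ⊑-trans (tick-mono (⊕-mono q (⊑-refl {r = r₂}))) p
  go (t ·ʳ W) (app {r₁ = r₁} {r₂} d e p) with go W e
  ... | r′ , e′ , q = _ , app d e′ ⊑-refl ,
    ⊑-trans (tick-mono (⊑-trans (tick-⊕ʳ r₁ r′) (⊕-mono (⊑-refl {r = r₁}) q))) p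
  go (ƛ W) (abs d p) with go W d
  ... | (M ∷ Γ , k) , d′ , (e ∷ q , l) =
    _ , abs (⊩-mono (e ∷ q , ℕ.≤-refl) d′) ⊑-refl , ⊑-trans (⊎.refl , s≤s l) p
  go (der W) (dr d p) with go W d
  ... | r′ , d′ , q = _ , dr d′ ⊑-refl , ⊑-trans (tick-mono q) p
  go (W [ u ]ˡ) (es {r₂ = r₂} d e p) with go W d
  ... | (M ∷ Γ , k) , d′ , (f ∷ q , l) =
    _ , es (⊩-mono (f ∷ q , ℕ.≤-refl) d′) e ⊑-refl ,
    ⊑-trans (tick-mono (⊕-mono (⊎.refl , l) (⊑-refl {r = r₂}))) p
  go (t [ W ]ʳ) (es {r₁ = r₁} d e p) with go W e
  ... | r′ , e′ , q = _ , es d e′ ⊑-refl ,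
    ⊑-trans (tick-mono (⊑-trans (tick-⊕ʳ r₁ r′) (⊕-mono (⊑-refl {r = r₁}) q))) p

-- The contraction is undone from the inside: recover what was moved under `L`, then frame its
-- context out of `L`.
↦-expansion : ∀ {n} {t u : Term n} {a r τ} → t ↦[ a ] u → r ⊩ u ∶ τ →
              ∃[ k ] (proj₁ r , k) ⊩ t ∶ τ
↦-expansion (dB L t u) d with plug⁻ L d
... | s , l , es {r₁ = s₁} d₁ d₂ p with rename⁻ (wk L) u d₂
... | q , e , p′
  with frame⁻ (proj₁ q) l (⊎.trans (⊎.sym (ctx p)) (⊎-cong ⊎.refl (⊎.sym (ctx p′))))
              -- The hole will hold an abstraction, one rule more than its body.
              (suc (proj₂ s₁))
... | r₀ , l′ , f = _ , app (plug⁺ l′ (abs d₁ ⊑-refl)) e (⊎.sym f , ℕ.≤-refl)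
↦-expansion (s! t L u) d with plug⁻ L d
... | s , l , d₁ with subst⁻ (single u) (rename (ext (wk L)) t) d₁
-- After the substitution, the renaming is undone too. `M` then types the bound variable of `t`, and
-- the environment yields a bag of derivations of `u` for it, which becomes the `bg`.
... | q₁ , d₂ , E with rename⁻ (ext (wk L)) t d₂
... | q₂@(M ∷ Θ , j) , d₃ , p
  with single⁻ (Item-≈ᶜ (⊎.trans (⊎.sym (ctx p)) (push-ext (wk L) M Θ)) E)
... | s₀ , b , f with frame⁻ Θ l f (proj₂ s₀)
... | r₀ , l′ , g =
  _ , es d₃ (plug⁺ l′ (bg b ≈ᴹ-refl)) (⊎.trans (⊎.comm Θ _) (⊎.sym g) , ℕ.≤-refl)
↦-expansion (d! L t) d with plug⁻ L d
... | s , l , d′ =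
  _ , dr (plug⁺ l (bg (add d′ ([] ⊑-refl) (≈⇒⊑ (⊕.identityʳ s))) ≈ᴹ-refl)) (⊎.refl , ℕ.≤-refl)

→w-expansion : ∀ {n} {t u : Term n} {a r τ} → t →w[ a ] u → r ⊩ u ∶ τ →
               ∃[ k ] (proj₁ r , k) ⊩ t ∶ τ
→w-expansion (step W x) = go W
  where
  go : ∀ {n} (W : WCtx n _) {r τ} → r ⊩ W ⟨ _ ⟩ᵂ ∶ τ → ∃[ k ] (proj₁ r , k) ⊩ W ⟨ _ ⟩ᵂ ∶ τ
  go □          d = ↦-expansion x d
  go (W ·ˡ u) (app d e p) with go W d
  ... | _ , d′ = _ , app d′ e (ctx p , ℕ.≤-refl)
  go (t ·ʳ W) (app d e p) with go W e
  ... | _ , e′ = _ , app d e′ (ctx p , ℕ.≤-refl)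
  go (ƛ W) (abs d p) with go W d
  ... | _ , d′ = _ , abs d′ (ctx p , ℕ.≤-refl)
  go (der W) (dr d p) with go W d
  ... | _ , d′ = _ , dr d′ (ctx p , ℕ.≤-refl)
  go (W [ u ]ˡ) (es d e p) with go W d
  ... | _ , d′ = _ , es d′ e (ctx p , ℕ.≤-refl)
  go (t [ W ]ʳ) (es d e p) with go W e
  ... | _ , e′ = _ , es d e′ (ctx p , ℕ.≤-refl)

-- Normalisation

mutual
  complete : ∀ {n} {Γ : Ctx n} {t τ} (Φ : Γ ⊢ t ∶ τ) → (Γ , sz Φ) ⊩ t ∶ τ
  complete ax           = var ⊑-refl
  complete (es Φ Ψ)     = es (complete Φ) (complete Ψ) ⊑-refl
  complete (abs Φ)      = abs (complete Φ) ⊑-refl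
  complete (app Φ Ψ)    = app (complete Φ) (complete Ψ) ⊑-refl
  complete (bg Φs)      = bg (complete! Φs) ≈ᴹ-refl
  complete (dr Φ)       = dr (complete Φ) ⊑-refl
  complete (conv p e Φ) = ⊩-mono (p , ℕ.≤-refl) (⊩-≈ e (complete Φ))

  complete! : ∀ {n} {Γ : Ctx n} {t M} (Φs : Γ ⊢! t ∶ M) → Bag (_⊩ t ∶_) M (Γ , sz! Φs)
  complete! []       = [] ⊑-refl
  complete! (Φ ∷ Φs) = add (complete Φ) (complete! Φs) ⊑-refl

-- Each side condition becomes a use of `conv`. The size bound is dropped, since this direction only
-- transports typability.
sound : ∀ {n} (t : Term n) {r τ} → r ⊩ t ∶ τ → proj₁ r ⊢ t ∶ τ
sound (` i)     (var p)     = conv (ctx p) ≈-refl ax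
sound (t · u)   (app d e p) = conv (ctx p) ≈-refl (app (sound t d) (sound u e))
sound (ƛ t)     (abs d p)   = conv (ctx p) ≈-refl (abs (sound t d))
sound (! t)     (bg b e)    with go b
  where
  go : ∀ {M r} → Bag (_⊩ t ∶_) M r → ∃[ Γ ] (Γ ⊢! t ∶ M × Γ ≈ᶜ proj₁ r)
  go ([] p)      = ∅ , [] , ctx p
  go (add d b p) with go b
  ... | Γ , Φs , q = _ , sound t d ∷ Φs , ⊎.trans (⊎-cong ⊎.refl q) (ctx p)
... | Γ , Φs , q = conv q (mset e) (bg Φs)
sound (der t)   (dr d p)    = conv (ctx p) ≈-refl (dr (sound t d))
sound (t [ u ]) (es d e p)  = conv (ctx p) ≈-refl (es (sound t d) (sound u e))

∣∣w≤size : ∀ {n} (t : Term n) {r τ} → r ⊩ t ∶ τ → ∣ t ∣w ≤ proj₂ r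
∣∣w≤size (` i)     d           = z≤n
∣∣w≤size (t · u)   (app d e p) =
  ℕ.≤-trans (s≤s (ℕ.+-mono-≤ (∣∣w≤size t d) (∣∣w≤size u e))) (size p)
∣∣w≤size (ƛ t)     (abs d p)   = ℕ.≤-trans (s≤s (∣∣w≤size t d)) (size p)
∣∣w≤size (! t)     d           = z≤n
∣∣w≤size (der t)   (dr d p)    = ℕ.≤-trans (s≤s (∣∣w≤size t d)) (size p)
∣∣w≤size (t [ u ]) (es d e p)  =
  ℕ.≤-trans (s≤s (ℕ.+-mono-≤ (∣∣w≤size t d) (∣∣w≤size u e))) (size p)

-- The shape of a normal term decides which redex it forms with its surroundings.
data Shape {n} : Term n → Set where
  neutral     : ∀ {t} → Ne t → Shape t
  bang        : ∀ {m} (L : LCtx n m) u → Shape (L ⟨ ! u ⟩ᴸ)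
  abstraction : ∀ {m} (L : LCtx n m) u → Shape (L ⟨ ƛ u ⟩ᴸ)

shape-[] : ∀ {n} {t : Term (suc n)} {u} → Shape t → Ne u → Shape (t [ u ])
shape-[] (neutral a)       b = neutral (a [ b ])
shape-[] (bang L u)        b = bang (L [ _ ]) u
shape-[] (abstraction L u) b = abstraction (L [ _ ]) u

Na-shape : ∀ {n} {t : Term n} → Na t → Shape t
Na-shape (! t)     = bang □ t
Na-shape (ne a)    = neutral a
Na-shape (a [ b ]) = shape-[] (Na-shape a) b

-- Below its explicit substitutions an `Nb` has either a neutral core, and then the same
-- substitutions can be rebuilt in `Na`, or an abstraction.
Nb⇒Na⊎abstraction : ∀ {n} {t : Term n} → Nb t →
                    Na t ⊎′ (∃[ m ] ∃[ L ] ∃[ u ] t ≡ _⟨_⟩ᴸ {n} {m} L (ƛ u))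
Nb⇒Na⊎abstraction (ne a)         = inj₁ (ne a)
Nb⇒Na⊎abstraction (ƛ_ {t = t} a) = inj₂ (_ , □ , t , refl)
Nb⇒Na⊎abstraction (a [ b ]) with Nb⇒Na⊎abstraction a
... | inj₁ a′                 = inj₁ (a′ [ b ])
... | inj₂ (_ , L , u , refl) = inj₂ (_ , L [ _ ] , u , refl)

No-shape : ∀ {n} {t : Term n} → No t → Shape t
No-shape (na a) = Na-shape a
No-shape (nb b) with Nb⇒Na⊎abstraction b
... | inj₁ a                  = Na-shape a
... | inj₂ (_ , L , u , refl) = abstraction L u

No-[] : ∀ {n} {t : Term (suc n)} {u} → No t → Ne u → No (t [ u ])
No-[] (na a) b = na (a [ b ])
No-[] (nb a) b = nb (a [ b ])

-- A list context passes on the type of its hole, and `bg` yields only multiset types; this excludes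
-- the clash of a `!` in function position.
bang-⇏ : ∀ {n m} (L : LCtx n m) {u r M τ} → ¬ (r ⊩ L ⟨ ! u ⟩ᴸ ∶ M ⇒ τ)
bang-⇏ L d with plug⁻ L d
... | _ , _ , ()

-- Likewise `abs` yields only arrow types; this excludes an abstraction under `der`, as the content
-- of a substitution, or as the argument of a neutral term.
abstraction-≢mset : ∀ {n m} (L : LCtx n m) {u r M} → ¬ (r ⊩ L ⟨ ƛ u ⟩ᴸ ∶ mset M)
abstraction-≢mset L d with plug⁻ L d
... | _ , _ , ()

No-mset⇒Na : ∀ {n} {t : Term n} {r M} → No t → r ⊩ t ∶ mset M → Na t
No-mset⇒Na (na a) d = a
No-mset⇒Na (nb b) d with Nb⇒Na⊎abstraction b
... | inj₁ a                = a
... | inj₂ (_ , L , u , refl) = ⊥-elim (abstraction-≢mset L d)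

-- At each eliminator the shape of the normal subterm that it acts on decides: one shape makes a
-- redex, a neutral one blocks, and the third is a clash excluded by its type.
progress : ∀ {n} (t : Term n) {r τ} → r ⊩ t ∶ τ → (∃[ u ] t →w u) ⊎′ No t
progress (` i) d = inj₂ (na (ne (` i)))
progress (! t) d = inj₂ (na (! t))
progress (ƛ t) (abs d p) with progress t d
... | inj₁ (_ , a , step W x) = inj₁ (_ , a , step (ƛ W) x)
... | inj₂ n                  = inj₂ (nb (ƛ n))
progress (der t) (dr d p) with progress t d
... | inj₁ (_ , a , step W x) = inj₁ (_ , a , step (der W) x)
... | inj₂ n with No-shape n
... | neutral a       = inj₂ (na (ne (der a)))
... | bang L u        = inj₁ (_ , d! , step □ (d! L u))
... | abstraction L u = ⊥-elim (abstraction-≢mset L d)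
progress (t · u) (app d e p) with progress t d
... | inj₁ (_ , a , step W x) = inj₁ (_ , a , step (W ·ˡ u) x)
... | inj₂ n with No-shape n
... | bang L v        = ⊥-elim (bang-⇏ L d)
... | abstraction L v = inj₁ (_ , dB , step □ (dB L v u))
-- Only here is the argument inspected: an abstraction in function position fires `dB` whatever its
-- argument.
... | neutral a with progress u e
... | inj₁ (_ , b , step W x) = inj₁ (_ , b , step (t ·ʳ W) x)
... | inj₂ n′                 = inj₂ (na (ne (a · No-mset⇒Na n′ e)))
progress (t [ u ]) (es d e p) with progress t d
... | inj₁ (_ , a , step W x) = inj₁ (_ , a , step (W [ u ]ˡ) x)
... | inj₂ n with progress u e
... | inj₁ (_ , b , step W x) = inj₁ (_ , b , step (t [ W ]ʳ) x)
... | inj₂ n′ with No-shape n′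
... | neutral a       = inj₂ (No-[] n a)
... | bang L v        = inj₁ (_ , s! , step □ (s! t L v))
... | abstraction L v = ⊥-elim (abstraction-≢mset L e)

Normalisation : ∀ {n} → Term n → ℕ → Set
Normalisation t k =
  ∃[ p ] ∃[ b ] ∃[ e ] (No p × t ↠w[ b , e ] p × k ≥ b + e + ∣ p ∣w)

prepend : ∀ {n} {t u : Term n} {k} a → t →w[ a ] u → Normalisation u k → Normalisation t (suc k)
prepend {k = k} a x (p , b , e , n , s , q) = go a x
  where
  suc-e : b + suc e + ∣ p ∣w ≤ suc k
  suc-e = ≡.subst (λ l → l + ∣ p ∣w ≤ suc k) (≡.sym (ℕ.+-suc b e)) (s≤s q)

  go : ∀ a → _ →w[ a ] _ → Normalisation _ (suc k)
  go dB x = p , suc b , e , n , dB-∷ x s , s≤s q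
  go s! x = p , b , suc e , n , s!-∷ x s , suc-e
  go d! x = p , b , suc e , n , d!-∷ x s , suc-e

normalise : ∀ {n} k {t : Term n} {Γ τ} → (Γ , k) ⊩ t ∶ τ → Normalisation t k
normalise k {t} d with progress t d
... | inj₂ n = t , 0 , 0 , n , done , ∣∣w≤size t d
... | inj₁ (u , a , x) with →w-reduction x d
-- The lost tick forces the bound to be a successor, so the bound itself is the recursion measure,
-- and each unit of it pays for one step. What is left at the end bounds the weak size.
normalise (suc k) d | inj₁ (u , a , x) | r′ , d′ , (_ , s≤s q) =
  prepend a x (normalise k (⊩-mono (⊎.refl , q) d′))

↠w[]⇒↠w : ∀ {n} {t p : Term n} {b e} → t ↠w[ b , e ] p → t ↠w p
↠w[]⇒↠w done       = ε
↠w[]⇒↠w (dB-∷ x s) = (_ , x) ◅ ↠w[]⇒↠w s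
↠w[]⇒↠w (s!-∷ x s) = (_ , x) ◅ ↠w[]⇒↠w s
↠w[]⇒↠w (d!-∷ x s) = (_ , x) ◅ ↠w[]⇒↠w s

-- Typability of normal terms and its transport to their expansions

mutual
  -- The type is arbitrary so that a head can receive the arrow or singleton that its surroundings
  -- require, and a substituted neutral term the multiset that the body demands.
  Ne-typable : ∀ {n} {t : Term n} → Ne t → ∀ σ → ∃[ Γ ] Γ ⊢ t ∶ σ
  Ne-typable (` i)   σ = _ , ax
  Ne-typable (a · b) σ with Na-typable b
  ... | M , _ , Ψ with Ne-typable a (M ⇒ σ)
  ... | _ , Φ = _ , app Φ Ψ
  Ne-typable (der a) σ with Ne-typable a (mset (σ ∷ []))
  ... | _ , Φ = _ , dr Φ
  Ne-typable (a [ b ]) σ with Ne-typable a σ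
  ... | M ∷ _ , Φ with Ne-typable b (mset M)
  ... | _ , Ψ = _ , es Φ Ψ

  -- Some multiset suffices, because the neutral head applied to the term adapts to it. A `!` takes
  -- the empty one, which leaves its arbitrary body untyped.
  Na-typable : ∀ {n} {t : Term n} → Na t → ∃[ M ] ∃[ Γ ] Γ ⊢ t ∶ mset M
  Na-typable (! t)     = [] , _ , bg []
  Na-typable (ne a)    = [] , Ne-typable a (mset [])
  Na-typable (a [ b ]) with Na-typable a
  ... | N , M ∷ _ , Φ with Ne-typable b (mset M)
  ... | _ , Ψ = N , _ , es Φ Ψ

mutual
  Nb-typable : ∀ {n} {t : Term n} → Nb t → Typable t
  Nb-typable (ne a) with Ne-typable a (base 0)
  ... | _ , Φ = _ , _ , Φ
  Nb-typable (ƛ a) with No-typable a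
  ... | _ ∷ _ , _ , Φ = _ , _ , abs Φ
  Nb-typable (a [ b ]) with Nb-typable a
  ... | M ∷ _ , _ , Φ with Ne-typable b (mset M)
  ... | _ , Ψ = _ , _ , es Φ Ψ

  No-typable : ∀ {n} {t : Term n} → No t → Typable t
  No-typable (na a) with Na-typable a
  ... | _ , _ , Φ = _ , _ , Φ
  No-typable (nb a) = Nb-typable a

↠w-expansion : ∀ {n} {t p : Term n} → t ↠w p → Typable p → Typable t
↠w-expansion ε              T = T
↠w-expansion ((_ , x) ◅ s)  T with ↠w-expansion s T
... | Γ , σ , Φ = Γ , σ , sound _ (proj₂ (→w-expansion x (complete Φ)))

theorem3p9 : ∀ {n : ℕ} (t : Term n) →
    (Typable t ⇔ (∃[ p ] (No p × t ↠w p)))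
    × (∀ {Γ : Ctx n} {τ : Type} (Φ : Γ ⊢ t ∶ τ) →
    ∃[ p ] ∃[ b ] ∃[ e ]
    (No p × t ↠w[ b , e ] p × sz Φ ≥ b + e + ∣ p ∣w))
theorem3p9 t =
  mk⇔ (λ (_ , _ , Φ) → let p , _ , _ , n , s , _ = normalise _ (complete Φ) in p , n , ↠w[]⇒↠w s)
      (λ (_ , n , s) → ↠w-expansion s (No-typable n)) ,
  λ Φ → normalise _ (complete Φ)
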